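{- Let $G$ be a twin-free graph on $n$ vertices, with domination number $\gamma(G)$ and maximum degree $\Delta(G)$. Then $$\mathrm{sep}(G)\leq\min\big\{\lceil\log_2(n)\rceil\cdot\text{max-sep}_{RB}(G),\ \lceil\log_2(\Delta(G)+1)\rceil\cdot\text{max-sep}_{RB}(G)+\gamma(G)\big\}.$$
   Context: All graphs are finite, simple and undirected. $N[x]$ denotes the closed neighborhood of $x$. A graph is twin-free if no two distinct vertices have the same closed neighborhood. A red-blue coloring of $G$ is a map $c:V(G)\to\{\text{red},\text{blue}\}$. A red-blue separating set of $(G,c)$ is a set $S\subseteq V(G)$ such that $N[r]\cap S\neq N[b]\cap S$ for every red vertex $r$ and every blue vertex $b$. For $G$ twin-free, $\mathrm{sep}_{RB}(G,c)$ is the smallest size of a red-blue separating set of $(G,c)$, and $\text{max-sep}_{RB}(G)$ is the maximum of $\mathrm{sep}_{RB}(G,c)$ over all red-blue colorings $c$ of $G$. For $G$ twin-free, $\mathrm{sep}(G)$ is the smallest size of a set $S\subseteq V(G)$ such that $N[x]\cap S\neq N[y]\cap S$ for all distinct vertices $x,y$ of $G$. The domination number $\gamma(G)$ is the smallest size of a set $D\subseteq V(G)$ with $N[v]\cap D\neq\emptyset$ for every $v\in V(G)$. -}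

module Defs where

open import Data.Bool.Properties using () renaming (_≟_ to _≟ᵇ_)
open import Data.Fin.Base using (Fin)
open import Data.Fin.Properties using (_≟_; all?)
open import Data.Fin.Subset using (Subset; ⊤; inside; outside; _∩_; ∣_∣; Nonempty; _∈_)
open import Data.Fin.Subset.Properties using (∩-identityʳ; nonempty?)
open import Data.List.Base using (List; []; _∷_; map; filter; allFin; cartesianProductWith)
open import Data.List.Extrema.Nat using (min; max)
open import Data.Nat.Base using (ℕ; zero; suc)
open import Data.Product.Base using (∃; _,_)
open import Data.Sum.Base using (inj₁)
open import Data.Vec.Base using (Vec; []; _∷_; lookup; tabulate)
open import Data.Vec.Properties using (≡-dec; lookup∘tabulate; lookup⇒[]=)
open import Level using (0ℓ)
open import Relation.Binary.Core using (Rel)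
open import Relation.Binary.Definitions using (Symmetric; Irreflexive; DecidableEquality) renaming (Decidable to Decidable₂)
open import Relation.Binary.PropositionalEquality using (_≡_; _≢_; refl; sym; trans; subst)
open import Relation.Nullary.Decidable using (does; yes; no; ¬?; _→-dec_; _⊎-dec_; dec-true)
open import Relation.Unary using (Pred; Decidable)

-- Decidability of adjacency, automatic classically, is what lets the graph
-- parameters below be computed.
record Graph (n : ℕ) : Set₁ where
  infix 4 _~_ _~?_
  field
    _~_      : Rel (Fin n) 0ℓ
    _~?_     : Decidable₂ _~_
    ~-sym    : Symmetric _~_
    ~-irrefl : Irreflexive _≡_ _~_

data Colour : Set where
  red blue : Colour

_≟ᶜ_ : DecidableEquality Colour
red  ≟ᶜ red  = yes refl
red  ≟ᶜ blue = no λ ()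
blue ≟ᶜ red  = no λ ()
blue ≟ᶜ blue = yes refl

Colouring : ℕ → Set
Colouring n = Vec Colour n

allVecs : ∀ {A : Set} → List A → (n : ℕ) → List (Vec A n)
allVecs as zero    = [] ∷ []
allVecs as (suc n) = cartesianProductWith _∷_ as (allVecs as n)

allSubsets : (n : ℕ) → List (Subset n)
allSubsets = allVecs (inside ∷ outside ∷ [])

allColourings : (n : ℕ) → List (Colouring n)
allColourings = allVecs (red ∷ blue ∷ [])

-- The witness supplies the default value that min needs for an empty list.
-- Since it satisfies P, its size already occurs in the list, so the result does
-- not depend on which witness is given.
minSize : ∀ {n} {P : Pred (Subset n) 0ℓ} → Decidable P → ∃ P → ℕ
minSize {n} P? (S , _) = min ∣ S ∣ (map ∣_∣ (filter P? (allSubsets n)))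

module _ {n : ℕ} (G : Graph n) where
  open Graph G

  private
    _≟ˢ_ : DecidableEquality (Subset n)
    _≟ˢ_ = ≡-dec _≟ᵇ_

  neighbours : Fin n → Subset n
  neighbours x = tabulate (λ y → does (x ~? y))

  N[_] : Fin n → Subset n
  N[ x ] = tabulate (λ y → does ((x ≟ y) ⊎-dec (x ~? y)))

  degree : Fin n → ℕ
  degree x = ∣ neighbours x ∣

  Δ : ℕ
  Δ = max 0 (map degree (allFin n))

  TwinFree : Set
  TwinFree = ∀ x y → x ≢ y → N[ x ] ≢ N[ y ]

  IsSeparating : Pred (Subset n) 0ℓ
  IsSeparating S = ∀ x y → x ≢ y → N[ x ] ∩ S ≢ N[ y ] ∩ S

  IsRBSeparating : Colouring n → Pred (Subset n) 0ℓ
  IsRBSeparating c S =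
    ∀ r b → lookup c r ≡ red → lookup c b ≡ blue → N[ r ] ∩ S ≢ N[ b ] ∩ S

  IsDominating : Pred (Subset n) 0ℓ
  IsDominating D = ∀ v → Nonempty (N[ v ] ∩ D)

  isSeparating? : Decidable IsSeparating
  isSeparating? S = all? λ x → all? λ y →
    ¬? (x ≟ y) →-dec ¬? ((N[ x ] ∩ S) ≟ˢ (N[ y ] ∩ S))

  isRBSeparating? : ∀ c → Decidable (IsRBSeparating c)
  isRBSeparating? c S = all? λ r → all? λ b →
    (lookup c r ≟ᶜ red) →-dec ((lookup c b ≟ᶜ blue) →-dec
      ¬? ((N[ r ] ∩ S) ≟ˢ (N[ b ] ∩ S)))

  isDominating? : Decidable IsDominating
  isDominating? D = all? λ v → nonempty? (N[ v ] ∩ D)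

  ⊤-isSeparating : TwinFree → IsSeparating ⊤
  ⊤-isSeparating tf x y x≢y eq = tf x y x≢y
    (trans (sym (∩-identityʳ N[ x ])) (trans eq (∩-identityʳ N[ y ])))

  ⊤-isRBSeparating : TwinFree → ∀ c → IsRBSeparating c ⊤
  ⊤-isRBSeparating tf c r b cr cb = ⊤-isSeparating tf r b r≢b
    where
    r≢b : r ≢ b
    r≢b refl with () ← trans (sym cr) cb

  ⊤-isDominating : IsDominating ⊤
  ⊤-isDominating v = v , subst (v ∈_) (sym (∩-identityʳ N[ v ]))
    (lookup⇒[]= v N[ v ]
      (trans (lookup∘tabulate _ v) (dec-true ((v ≟ v) ⊎-dec (v ~? v)) (inj₁ refl))))

  sep : TwinFree → ℕ
  sep tf = minSize isSeparating? (⊤ , ⊤-isSeparating tf)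

  sepRB : TwinFree → Colouring n → ℕ
  sepRB tf c = minSize (isRBSeparating? c) (⊤ , ⊤-isRBSeparating tf c)

  -- The base value 0 has no effect: allColourings n is never empty.
  max-sepRB : TwinFree → ℕ
  max-sepRB tf = max 0 (map (sepRB tf) (allColourings n))

  γ : ℕ
  γ = minSize isDominating? (⊤ , ⊤-isDominating)

{-# OPTIONS --safe #-}

-- Give every vertex a label f x < m and suppose that D separates all pairs of
-- distinct vertices with equal labels. Colour the vertices by the parity of f
-- and add to D a red-blue separating set S of this colouring: D ∪ S separates
-- all pairs with equal ⌊ f /2⌋, and these labels are below ⌈ m /2⌉. After
-- ⌈log₂ m⌉ rounds a separating set remains. The first bound starts from
-- D = ∅ and the labelling toℕ. The second one starts from a minimum dominating
-- set D: vertices with the same trace N[ x ] ∩ D have a common dominator, so at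
-- most Δ + 1 vertices share a trace, and each is labelled by its rank among them.
module Submission where

open import Defs
open import Data.Bool.Properties using () renaming (_≟_ to _≟ᵇ_)
open import Data.Fin.Base using (Fin; toℕ) renaming (_<_ to _<ᶠ_)
open import Data.Fin.Properties using (_≟_; _<?_; <-cmp; <-irrefl; <-trans; toℕ<n; toℕ-injective)
open import Data.Fin.Subset using (Subset; ⊤; ⊥; ⁅_⁆; inside; outside; _∩_; _∪_; ∣_∣; _∈_; _⊆_)
open import Data.Fin.Subset.Properties
  using (∩-assoc; ∩-comm; ∪-comm; ∩-abs-∪; x∈p∩q⁻; x∈p∪q⁺; x∈⁅x⁆; ∣⁅x⁆∣≡1; ∣⊥∣≡0; p⊆q⇒∣p∣≤∣q∣; p⊂q⇒∣p∣<∣q∣)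
open import Data.List.Base using (List; []; _∷_; map; filter)
open import Data.List.Extrema.Nat using (argmin-sel; min≤xs; xs≤max)
open import Data.List.Membership.Propositional using () renaming (_∈_ to _∈ˡ_)
open import Data.List.Membership.Propositional.Properties
  using (∈-cartesianProductWith⁺; ∈-map⁺; ∈-map⁻; ∈-filter⁺; ∈-filter⁻; ∈-allFin)
open import Data.List.Relation.Unary.All using () renaming (lookup to All-lookup)
open import Data.List.Relation.Unary.Any using (here; there)
open import Data.Nat.Base using (ℕ; zero; suc; _+_; _*_; _≤_; _<_; _⊓_; z≤n; s≤s; ⌊_/2⌋; ⌈_/2⌉)
open import Data.Nat.Induction using (Acc; acc; <-wellFounded)
open import Data.Nat.Logarithm using (⌈log₂_⌉; ⌈log₂⌈n/2⌉⌉≡⌈log₂n⌉∸1)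
open import Data.Nat.Properties as ℕ using (module ≤-Reasoning)
open import Data.Product.Base using (∃; _×_; _,_; proj₁; proj₂)
open import Data.Sum.Base using (_⊎_; inj₁; inj₂)
open import Data.Vec.Base using (Vec; []; _∷_; lookup; tabulate)
open import Data.Vec.Properties using (≡-dec; lookup∘tabulate; lookup⇒[]=; []=⇒lookup)
open import Function.Base using (id; _∘_)
open import Level using (0ℓ)
open import Relation.Binary.Definitions using (DecidableEquality; tri<; tri≈; tri>)
open import Relation.Binary.PropositionalEquality
  using (_≡_; _≢_; refl; sym; trans; cong; subst; module ≡-Reasoning)
open import Relation.Nullary.Decidable using (does; yes; no; _×-dec_; _⊎-dec_; dec-true)
open import Relation.Nullary.Negation using (contradiction)
open import Relation.Unary using (Pred; Decidable)

∈-allVecs : ∀ {A : Set} {as : List A} → (∀ a → a ∈ˡ as) →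
            ∀ {n} (v : Vec A n) → v ∈ˡ allVecs as n
∈-allVecs ∈as []      = here refl
∈-allVecs ∈as (a ∷ v) = ∈-cartesianProductWith⁺ _∷_ (∈as a) (∈-allVecs ∈as v)

∈-allSubsets : ∀ {n} (S : Subset n) → S ∈ˡ allSubsets n
∈-allSubsets = ∈-allVecs λ { inside → here refl ; outside → there (here refl) }

∈-allColourings : ∀ {n} (c : Colouring n) → c ∈ˡ allColourings n
∈-allColourings = ∈-allVecs λ { red → here refl ; blue → there (here refl) }

module _ {n} {P : Pred (Subset n) 0ℓ} (P? : Decidable P) (w : ∃ P) where

  private
    sizes = map ∣_∣ (filter P? (allSubsets n))

  -- `min` returns its default value or an entry of the list. Both cases give a set satisfying `P`,
  -- since the default is the size of the witness `w`.
  minSize-attained : ∃ λ S → P S × ∣ S ∣ ≡ minSize P? w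
  minSize-attained with argmin-sel id ∣ proj₁ w ∣ sizes
  ... | inj₁ min≡∣w∣ = proj₁ w , proj₂ w , sym min≡∣w∣
  ... | inj₂ min∈
    with S , S∈ , min≡∣S∣ ← ∈-map⁻ ∣_∣ min∈
    = S , proj₂ (∈-filter⁻ P? {xs = allSubsets n} S∈) , sym min≡∣S∣

  minSize≤ : ∀ {S} → P S → minSize P? w ≤ ∣ S ∣
  minSize≤ {S} pS = All-lookup (min≤xs ∣ proj₁ w ∣ sizes)
    (∈-map⁺ ∣_∣ (∈-filter⁺ P? (∈-allSubsets S) pS))

∣p∪q∣≤∣p∣+∣q∣ : ∀ {n} (p q : Subset n) → ∣ p ∪ q ∣ ≤ ∣ p ∣ + ∣ q ∣
∣p∪q∣≤∣p∣+∣q∣ []            []            = z≤n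
∣p∪q∣≤∣p∣+∣q∣ (outside ∷ p) (outside ∷ q) = ∣p∪q∣≤∣p∣+∣q∣ p q
∣p∪q∣≤∣p∣+∣q∣ (outside ∷ p) (inside  ∷ q) =
  subst (suc ∣ p ∪ q ∣ ≤_) (sym (ℕ.+-suc ∣ p ∣ ∣ q ∣)) (s≤s (∣p∪q∣≤∣p∣+∣q∣ p q))
∣p∪q∣≤∣p∣+∣q∣ (inside  ∷ p) (outside ∷ q) = s≤s (∣p∪q∣≤∣p∣+∣q∣ p q)
∣p∪q∣≤∣p∣+∣q∣ (inside  ∷ p) (inside  ∷ q) =
  s≤s (ℕ.≤-trans (∣p∪q∣≤∣p∣+∣q∣ p q) (ℕ.+-monoʳ-≤ ∣ p ∣ (ℕ.n≤1+n ∣ q ∣)))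

-- Intersect both sides with `s` and absorb. Read contrapositively, a pair separated by `s` stays
-- separated when `s` is enlarged.
∩-∪-cancelˡ : ∀ {n} (p q s t : Subset n) → p ∩ (s ∪ t) ≡ q ∩ (s ∪ t) → p ∩ s ≡ q ∩ s
∩-∪-cancelˡ p q s t eq = trans (sym (restrict p)) (trans (cong (_∩ s) eq) (restrict q))
  where
  open ≡-Reasoning
  restrict : ∀ r → (r ∩ (s ∪ t)) ∩ s ≡ r ∩ s
  restrict r = begin
    (r ∩ (s ∪ t)) ∩ s  ≡⟨ ∩-assoc r (s ∪ t) s ⟩
    r ∩ ((s ∪ t) ∩ s)  ≡⟨ cong (r ∩_) (∩-comm (s ∪ t) s) ⟩
    r ∩ (s ∩ (s ∪ t))  ≡⟨ cong (r ∩_) (∩-abs-∪ s t) ⟩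
    r ∩ s              ∎

∩-∪-cancelʳ : ∀ {n} (p q s t : Subset n) → p ∩ (s ∪ t) ≡ q ∩ (s ∪ t) → p ∩ t ≡ q ∩ t
∩-∪-cancelʳ p q s t eq =
  ∩-∪-cancelˡ p q t s (subst (λ u → p ∩ u ≡ q ∩ u) (∪-comm s t) eq)

module _ {n} {P : Pred (Fin n) 0ℓ} (P? : Decidable P) where

  -- `N[_]` and `neighbours` are definitionally of this form, so the two membership lemmas below
  -- apply to them directly.
  comprehension : Subset n
  comprehension = tabulate (does ∘ P?)

  ∈-comprehension⁺ : ∀ {x} → P x → x ∈ comprehension
  ∈-comprehension⁺ {x} px = lookup⇒[]= x comprehension
    (trans (lookup∘tabulate _ x) (dec-true (P? x) px))

  ∈-comprehension⁻ : ∀ {x} → x ∈ comprehension → P x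
  -- Abstracting the equation together with `P? x` turns it into `outside ≡ inside` in the `no`
  -- case.
  ∈-comprehension⁻ {x} x∈ with P? x | trans (sym (lookup∘tabulate (does ∘ P?) x)) ([]=⇒lookup x∈)
  ... | yes px | _  = px
  ... | no _   | ()

module _ {n} {A : Set} (_≟ᴬ_ : DecidableEquality A) (key : Fin n → A) where

  private
    inFibre? : ∀ x → Decidable (λ y → key y ≡ key x)
    inFibre? x y = key y ≟ᴬ key x

    earlier? : ∀ x → Decidable (λ y → key y ≡ key x × y <ᶠ x)
    earlier? x y = inFibre? x y ×-dec y <? x

  fibre : Fin n → Subset n
  fibre x = comprehension (inFibre? x)

  rank : Fin n → ℕ
  rank x = ∣ comprehension (earlier? x) ∣

  ∈-fibre⁻ : ∀ {x y} → y ∈ fibre x → key y ≡ key x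
  ∈-fibre⁻ {x} = ∈-comprehension⁻ (inFibre? x)

  -- Strict because `x` lies in its own fibre but is not earlier than itself. Fibre sizes therefore
  -- bound the labels given by `rank`.
  rank<∣fibre∣ : ∀ x → rank x < ∣ fibre x ∣
  rank<∣fibre∣ x = p⊂q⇒∣p∣<∣q∣
    ( (λ z∈ → ∈-comprehension⁺ (inFibre? x) (proj₁ (∈-comprehension⁻ (earlier? x) z∈)))
    , x
    , ∈-comprehension⁺ (inFibre? x) refl
    , (λ x∈ → <-irrefl refl (proj₂ (∈-comprehension⁻ (earlier? x) x∈))))

  -- Whatever precedes `x` in the common fibre also precedes `y`, and `x` itself is counted for `y`
  -- only.
  rank-mono-< : ∀ {x y} → key x ≡ key y → x <ᶠ y → rank x < rank y
  rank-mono-< {x} {y} kx≡ky x<y = p⊂q⇒∣p∣<∣q∣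
    ( (λ z∈ → let kz≡kx , z<x = ∈-comprehension⁻ (earlier? x) z∈ in
              ∈-comprehension⁺ (earlier? y) (trans kz≡kx kx≡ky , <-trans z<x x<y))
    , x
    , ∈-comprehension⁺ (earlier? y) (kx≡ky , x<y)
    , (λ x∈ → <-irrefl refl (proj₂ (∈-comprehension⁻ (earlier? x) x∈))))

  rank-injective : ∀ {x y} → key x ≡ key y → rank x ≡ rank y → x ≡ y
  rank-injective {x} {y} kx≡ky rx≡ry with <-cmp x y
  ... | tri< x<y _ _ = contradiction rx≡ry (ℕ.<⇒≢ (rank-mono-< kx≡ky x<y))
  ... | tri≈ _ x≡y _ = x≡y
  ... | tri> _ _ y<x = contradiction (sym rx≡ry) (ℕ.<⇒≢ (rank-mono-< (sym kx≡ky) y<x))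

parity : ℕ → Colour
parity zero          = red
parity (suc zero)    = blue
parity (suc (suc m)) = parity m

-- The parity is the last binary digit and the half holds all the others.
parity∧half-injective : ∀ m n → parity m ≡ parity n → ⌊ m /2⌋ ≡ ⌊ n /2⌋ → m ≡ n
parity∧half-injective zero          zero          _ _ = refl
parity∧half-injective zero          (suc zero)    () _
parity∧half-injective zero          (suc (suc n)) _ ()
parity∧half-injective (suc zero)    zero          () _
parity∧half-injective (suc zero)    (suc zero)    _ _ = refl
parity∧half-injective (suc zero)    (suc (suc n)) _ ()
parity∧half-injective (suc (suc m)) zero          _ ()
parity∧half-injective (suc (suc m)) (suc zero)    _ ()
parity∧half-injective (suc (suc m)) (suc (suc n)) p h =
  cong (suc ∘ suc) (parity∧half-injective m n p (ℕ.suc-injective h))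

-- `⌈ n /2⌉` is by definition `⌊ suc n /2⌋`, so this is monotonicity of the floor applied to
-- `suc (suc m) ≤ suc n`.
m<n⇒⌊m/2⌋<⌈n/2⌉ : ∀ {m n} → m < n → ⌊ m /2⌋ < ⌈ n /2⌉
m<n⇒⌊m/2⌋<⌈n/2⌉ m<n = ℕ.⌊n/2⌋-mono (s≤s m<n)

module _ {n : ℕ} (G : Graph n) where
  open Graph G

  private
    inN? : ∀ x → Decidable (λ y → x ≡ y ⊎ x ~ y)
    inN? x y = (x ≟ y) ⊎-dec (x ~? y)

  ∣N[x]∣≤Δ+1 : ∀ x → ∣ N[_] G x ∣ ≤ Δ G + 1
  ∣N[x]∣≤Δ+1 x = begin
    ∣ N[_] G x ∣                 ≤⟨ p⊆q⇒∣p∣≤∣q∣ N⊆ ⟩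
    ∣ neighbours G x ∪ ⁅ x ⁆ ∣   ≤⟨ ∣p∪q∣≤∣p∣+∣q∣ (neighbours G x) ⁅ x ⁆ ⟩
    degree G x + ∣ ⁅ x ⁆ ∣       ≡⟨ cong (degree G x +_) (∣⁅x⁆∣≡1 x) ⟩
    degree G x + 1               ≤⟨ ℕ.+-monoˡ-≤ 1 (All-lookup (xs≤max 0 _) (∈-map⁺ (degree G) (∈-allFin x))) ⟩
    Δ G + 1                      ∎
    where
    open ≤-Reasoning
    N⊆ : N[_] G x ⊆ neighbours G x ∪ ⁅ x ⁆
    N⊆ {y} y∈ with ∈-comprehension⁻ (inN? x) y∈
    ... | inj₁ refl = x∈p∪q⁺ (inj₂ (x∈⁅x⁆ x))
    ... | inj₂ x~y  = x∈p∪q⁺ (inj₁ (∈-comprehension⁺ (x ~?_) x~y))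

  ∈N-sym : ∀ {x y} → y ∈ N[_] G x → x ∈ N[_] G y
  ∈N-sym {x} {y} y∈ with ∈-comprehension⁻ (inN? x) y∈
  ... | inj₁ x≡y = ∈-comprehension⁺ (inN? y) (inj₁ (sym x≡y))
  ... | inj₂ x~y = ∈-comprehension⁺ (inN? y) (inj₂ (~-sym x~y))

  module _ (tf : TwinFree G) where

    private
      M = max-sepRB G tf

    -- The form in which `max-sepRB` enters the argument: one bound `M` serves every colouring.
    smallRBSeparating : ∀ c → ∃ λ S → IsRBSeparating G c S × ∣ S ∣ ≤ M
    smallRBSeparating c
      with S , S-sep , ∣S∣≡ ← minSize-attained (isRBSeparating? G c) (⊤ , ⊤-isRBSeparating G tf c)
      = S , S-sep , ℕ.≤-trans (ℕ.≤-reflexive ∣S∣≡)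
          (All-lookup (xs≤max 0 _) (∈-map⁺ (sepRB G tf) (∈-allColourings c)))

    -- Frees the definition from prescribing which of the two vertices is red.
    IsRBSeparating⇒≢ : ∀ c {S} → IsRBSeparating G c S →
                       ∀ x y → lookup c x ≢ lookup c y → N[_] G x ∩ S ≢ N[_] G y ∩ S
    IsRBSeparating⇒≢ c S-sep x y cx≢cy with lookup c x in cx | lookup c y in cy
    ... | red  | red  = contradiction refl cx≢cy
    ... | red  | blue = S-sep x y cx cy
    ... | blue | red  = S-sep y x cy cx ∘ sym
    ... | blue | blue = contradiction refl cx≢cy

    -- The invariant of the halving. It holds for every `D` when `f` is injective, and says that `D`
    -- is separating when `f` is constant.
    SeparatesFibres : (Fin n → ℕ) → Subset n → Set
    SeparatesFibres f D = ∀ x y → x ≢ y → f x ≡ f y → N[_] G x ∩ D ≢ N[_] G y ∩ D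

    -- Two vertices with equal halves either differ in parity, and `S` separates them, or have equal
    -- labels, and `D` does.
    separateByParity : ∀ f D → SeparatesFibres f D →
      ∃ λ S → SeparatesFibres (⌊_/2⌋ ∘ f) (S ∪ D) × ∣ S ∣ ≤ M
    separateByParity f D D-sep
      with S , S-sep , ∣S∣≤M ← smallRBSeparating (tabulate (parity ∘ f))
      = S , separates , ∣S∣≤M
      where
      colour = lookup (tabulate (parity ∘ f))
      separates : SeparatesFibres (⌊_/2⌋ ∘ f) (S ∪ D)
      separates x y x≢y half≡ eq with colour x ≟ᶜ colour y
      ... | no cx≢cy  = IsRBSeparating⇒≢ (tabulate (parity ∘ f)) S-sep x y cx≢cy
                          (∩-∪-cancelˡ (N[_] G x) (N[_] G y) S D eq)
      ... | yes cx≡cy = D-sep x y x≢y (parity∧half-injective (f x) (f y) parity≡ half≡)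
                          (∩-∪-cancelʳ (N[_] G x) (N[_] G y) S D eq)
        where
        parity≡ : parity (f x) ≡ parity (f y)
        parity≡ = trans (sym (lookup∘tabulate (parity ∘ f) x))
                        (trans cx≡cy (lookup∘tabulate (parity ∘ f) y))

    sep≤-constantLabels : ∀ f D → (∀ x → f x < 1) → SeparatesFibres f D → sep G tf ≤ ∣ D ∣
    sep≤-constantLabels f D f<1 D-sep =
      minSize≤ (isSeparating? G) (⊤ , ⊤-isSeparating G tf) λ x y x≢y →
        D-sep x y x≢y (trans (ℕ.n<1⇒n≡0 (f<1 x)) (sym (ℕ.n<1⇒n≡0 (f<1 y))))

    -- Each round costs at most `M` vertices. Recursion is on accessibility because `⌈ m /2⌉` is not
    -- structurally smaller than `m`.
    sep≤-labels : ∀ m → Acc _<_ m → ∀ f D → (∀ x → f x < m) → SeparatesFibres f D →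
                  sep G tf ≤ ⌈log₂ m ⌉ * M + ∣ D ∣
    -- There is no vertex here, and `⌈log₂ 0 ⌉` computes to 0, so this joins the constant case.
    sep≤-labels 0 _ f D f<m = sep≤-constantLabels f D (ℕ.m<n⇒m<1+n ∘ f<m)
    sep≤-labels 1 _ f D f<m = sep≤-constantLabels f D f<m
    sep≤-labels m@(suc (suc k)) (acc rs) f D f<m D-sep
      with S , SD-sep , ∣S∣≤M ← separateByParity f D D-sep = begin
      sep G tf                          ≤⟨ sep≤-labels ⌈ m /2⌉ (rs (ℕ.⌈n/2⌉<n k))
                                             (⌊_/2⌋ ∘ f) (S ∪ D) (m<n⇒⌊m/2⌋<⌈n/2⌉ ∘ f<m) SD-sep ⟩
      L * M + ∣ S ∪ D ∣                 ≤⟨ ℕ.+-monoʳ-≤ (L * M) (∣p∪q∣≤∣p∣+∣q∣ S D) ⟩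
      L * M + (∣ S ∣ + ∣ D ∣)           ≤⟨ ℕ.+-monoʳ-≤ (L * M) (ℕ.+-monoˡ-≤ ∣ D ∣ ∣S∣≤M) ⟩
      L * M + (M + ∣ D ∣)               ≡⟨ ℕ.+-assoc (L * M) M ∣ D ∣ ⟨
      (L * M + M) + ∣ D ∣               ≡⟨ cong (_+ ∣ D ∣) (ℕ.+-comm (L * M) M) ⟩
      -- Since `m` is at least 2, `⌈log₂ m ⌉` computes to a successor, so `suc` undoes the truncated
      -- subtraction of 1.
      suc L * M + ∣ D ∣                 ≡⟨ cong (λ l → suc l * M + ∣ D ∣) (⌈log₂⌈n/2⌉⌉≡⌈log₂n⌉∸1 m) ⟩
      ⌈log₂ m ⌉ * M + ∣ D ∣             ∎
      where
      open ≤-Reasoning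
      L = ⌈log₂ ⌈ m /2⌉ ⌉

    sep≤⌈log₂n⌉*max-sepRB : sep G tf ≤ ⌈log₂ n ⌉ * M
    sep≤⌈log₂n⌉*max-sepRB = subst (sep G tf ≤_)
      (trans (cong (⌈log₂ n ⌉ * M +_) (∣⊥∣≡0 n)) (ℕ.+-identityʳ _))
      (sep≤-labels n (<-wellFounded n) toℕ ⊥ toℕ<n
        (λ x y x≢y eq _ → x≢y (toℕ-injective eq)))

    sep≤⌈log₂Δ+1⌉*max-sepRB+γ : sep G tf ≤ ⌈log₂ (Δ G + 1) ⌉ * M + γ G
    sep≤⌈log₂Δ+1⌉*max-sepRB+γ
      with D , D-dom , ∣D∣≡γ ← minSize-attained (isDominating? G) (⊤ , ⊤-isDominating G)
      = subst (λ g → sep G tf ≤ ⌈log₂ (Δ G + 1) ⌉ * M + g) ∣D∣≡γ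
          (sep≤-labels (Δ G + 1) (<-wellFounded _) (rank _≟ˢ_ trace) D
            (λ x → ℕ.<-≤-trans (rank<∣fibre∣ _≟ˢ_ trace x) (∣fibre∣≤Δ+1 x))
            -- The key of `rank` is the trace on `D` itself, so equal ranks and unseparated traces
            -- force `x ≡ y`.
            (λ x y x≢y rx≡ry tx≡ty → x≢y (rank-injective _≟ˢ_ trace tx≡ty rx≡ry)))
      where
      _≟ˢ_ = ≡-dec _≟ᵇ_
      trace : Fin n → Subset n
      trace x = N[_] G x ∩ D
      ∣fibre∣≤Δ+1 : ∀ x → ∣ fibre _≟ˢ_ trace x ∣ ≤ Δ G + 1
      ∣fibre∣≤Δ+1 x with d , d∈ ← D-dom x =
        ℕ.≤-trans (p⊆q⇒∣p∣≤∣q∣ fibre⊆) (∣N[x]∣≤Δ+1 d)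
        where
        fibre⊆ : fibre _≟ˢ_ trace x ⊆ N[_] G d
        -- The dominator `d` of `x` lies in the trace of `x`, hence in that of `y`; symmetry then
        -- puts `y` into the closed neighbourhood of `d`.
        fibre⊆ {y} y∈ = ∈N-sym (proj₁ (x∈p∩q⁻ (N[_] G y) D
          (subst (d ∈_) (sym (∈-fibre⁻ _≟ˢ_ trace y∈)) d∈)))

theorem10 : ∀ (n : ℕ) (G : Graph n) (tf : TwinFree G) →
    sep G tf ≤ (⌈log₂ n ⌉ * max-sepRB G tf) ⊓ (⌈log₂ (Δ G + 1) ⌉ * max-sepRB G tf + γ G)
theorem10 n G tf = ℕ.⊓-glb (sep≤⌈log₂n⌉*max-sepRB G tf) (sep≤⌈log₂Δ+1⌉*max-sepRB+γ G tf)
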